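{- For any tree $T$, there exists a non-empty elementary minor of $T$ with the same spectator floor as $T$ if and only if there exists an edge $e$ of $T$ such that contracting $e$ reduces the diameter of $T$.
   Context: All graphs are finite, have no loops, and may have multiple (parallel) edges. A minor of $H$ is any graph obtained from $H$ by a sequence of: deleting an isolated vertex, deleting an edge, contracting an edge that has no edge parallel to it; an elementary minor is one obtained by exactly one such operation. A unique shortest path is a shortest $u$–$v$ path $P$ such that every $u$–$v$ path with the same number of vertices is identical to $P$, where two paths with different edge sequences are different even if their vertex sequences agree; a single vertex is a unique shortest path. The parade number $\mathrm{usp}(G)$ is the largest number of vertices of a unique shortest path in $G$. The spectator number is $\mathrm{sp}(G)=|V(G)|-\mathrm{usp}(G)$. The spectator floor $\lfloor \mathrm{sp}\rfloor(G)$ is the minimum of $\mathrm{sp}(H)$ over all graphs $H$ of which $G$ is a minor. -}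

module Defs where

open import Data.Fin using (Fin)
open import Data.List using (List; []; _∷_; length)
open import Data.List.Membership.Propositional using (_∉_)
open import Data.List.Relation.Unary.Unique.Propositional using (Unique)
open import Data.Nat using (ℕ; _+_; _≤_; _<_)
open import Data.Product using (Σ-syntax; ∃-syntax; _×_; _,_)
open import Data.Sum using (_⊎_)
open import Function using (Injective; StrictlySurjective; flip; _↔_; Inverse)
open import Relation.Binary.Construct.Closure.ReflexiveTransitive using (Star)
open import Relation.Binary.PropositionalEquality using (_≡_; _≢_)
open import Relation.Nullary using (¬_)

-- Finite loopless multigraphs.  The order of the pair 'ends e' carries no
-- meaning: everything below refers to it only through the symmetric 'Joins'.
record Graph : Set where
  field
    order    : ℕ
    size     : ℕ
    ends     : Fin size → Fin order × Fin order
    loopless : ∀ e x → ends e ≢ (x , x)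

open Graph public

Vertex Edge : Graph → Set
Vertex G = Fin (order G)
Edge   G = Fin (size G)

NonEmpty : Graph → Set
NonEmpty = Vertex

Joins : (G : Graph) → Edge G → Vertex G → Vertex G → Set
Joins G e x y = (ends G e ≡ (x , y)) ⊎ (ends G e ≡ (y , x))

module _ (G : Graph) where

  data Walk : Vertex G → Vertex G → Set where
    stop : ∀ {x} → Walk x x
    step : ∀ {x y z} (e : Edge G) → Joins G e x y → Walk y z → Walk x z

  vertices : ∀ {u v} → Walk u v → List (Vertex G)
  vertices {u} stop         = u ∷ []
  vertices {u} (step _ _ w) = u ∷ vertices w

  edges : ∀ {u v} → Walk u v → List (Edge G)
  edges stop         = []
  edges (step e _ w) = e ∷ edges w

  Path : Vertex G → Vertex G → Set
  Path u v = Σ[ w ∈ Walk u v ] Unique (vertices w)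

  pathEdges : ∀ {u v} → Path u v → List (Edge G)
  pathEdges (w , _) = edges w

  vertexCount pathLength : ∀ {u v} → Path u v → ℕ
  vertexCount (w , _) = length (vertices w)
  pathLength  (w , _) = length (edges w)

  IsShortest : ∀ {u v} → Path u v → Set
  IsShortest {u} {v} P = (Q : Path u v) → pathLength P ≤ pathLength Q

  -- A path with given end vertices is determined by its edge sequence, so
  -- "Q is identical to P" is equality of edge sequences; comparing vertex
  -- sequences instead would wrongly identify paths using parallel edges.
  IsUniqueShortest : ∀ {u v} → Path u v → Set
  IsUniqueShortest {u} {v} P =
    IsShortest P ×
    ((Q : Path u v) → vertexCount Q ≡ vertexCount P → pathEdges Q ≡ pathEdges P)

  Connected : Set
  Connected = ∀ u v → Path u v

  -- A cycle is a path together with a further edge joining its ends; in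
  -- particular two parallel edges form a cycle.
  Cycle : Set
  Cycle = ∃[ u ] ∃[ v ] Σ[ P ∈ Path u v ] ∃[ e ] (Joins G e u v × e ∉ pathEdges P)

  record IsTree : Set where
    field
      nonEmpty  : NonEmpty G
      connected : Connected
      acyclic   : ¬ Cycle

-- Numerical invariants are given by their graphs: 'IsX G k' says that the
-- invariant X of G is defined and equals k.

IsMinimum IsMaximum : (ℕ → Set) → ℕ → Set
IsMinimum A k = A k × (∀ j → A j → k ≤ j)
IsMaximum A k = A k × (∀ j → A j → j ≤ k)

IsDistance : (G : Graph) → Vertex G → Vertex G → ℕ → Set
IsDistance G u v = IsMinimum (λ k → Σ[ P ∈ Path G u v ] pathLength G P ≡ k)

IsDiameter : Graph → ℕ → Set
IsDiameter G d =
  Connected G × IsMaximum (λ k → ∃[ u ] ∃[ v ] IsDistance G u v k) d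

IsParadeNumber : Graph → ℕ → Set
IsParadeNumber G = IsMaximum λ k →
  ∃[ u ] ∃[ v ] Σ[ P ∈ Path G u v ] (IsUniqueShortest G P × vertexCount G P ≡ k)

IsSpectatorNumber : Graph → ℕ → Set
IsSpectatorNumber G s = ∃[ k ] (IsParadeNumber G k × s + k ≡ order G)

-- The three operations relate H to every graph G isomorphic to the result,
-- exhibited by explicit maps between the vertices and edges of G and H.

record EnumeratesAllBut {m n : ℕ} (i : Fin n) (f : Fin m → Fin n) : Set where
  field
    injective : Injective _≡_ _≡_ f
    avoids    : ∀ j → f j ≢ i
    covers    : ∀ x → x ≢ i → ∃[ j ] f j ≡ x

Isolated : (G : Graph) → Vertex G → Set
Isolated G v = ∀ e x → ¬ Joins G e v x

record VertexDeletion (H : Graph) (v : Vertex H) (G : Graph) : Set where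
  field
    isolated       : Isolated H v
    vertexMap      : Vertex G → Vertex H
    vertexMap-all  : EnumeratesAllBut v vertexMap
    edgeMap        : Edge G ↔ Edge H
    preservesJoins : ∀ f x y → Joins G f x y →
                     Joins H (Inverse.to edgeMap f) (vertexMap x) (vertexMap y)

record EdgeDeletion (H : Graph) (e : Edge H) (G : Graph) : Set where
  field
    vertexMap      : Vertex G ↔ Vertex H
    edgeMap        : Edge G → Edge H
    edgeMap-all    : EnumeratesAllBut e edgeMap
    preservesJoins : ∀ f x y → Joins G f x y →
                     Joins H (edgeMap f) (Inverse.to vertexMap x) (Inverse.to vertexMap y)

HasNoParallel : (G : Graph) → Edge G → Set
HasNoParallel G e = ∀ f x y → Joins G e x y → Joins G f x y → f ≡ e

-- 'vertexMap' is the quotient map identifying the two ends of e and nothing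
-- else; unlike in the deletions it goes from H to G.
record Contraction (H : Graph) (e : Edge H) (G : Graph) : Set where
  field
    noParallel     : HasNoParallel H e
    vertexMap      : Vertex H → Vertex G
    surjective     : StrictlySurjective _≡_ vertexMap
    identifies     : ∀ x y → Joins H e x y → vertexMap x ≡ vertexMap y
    separates      : ∀ x y → vertexMap x ≡ vertexMap y → (x ≡ y) ⊎ Joins H e x y
    edgeMap        : Edge G → Edge H
    edgeMap-all    : EnumeratesAllBut e edgeMap
    preservesJoins : ∀ f x y → Joins H (edgeMap f) x y →
                     Joins G f (vertexMap x) (vertexMap y)

data _IsElementaryMinorOf_ (G H : Graph) : Set where
  deleteVertex : ∀ v → VertexDeletion H v G → G IsElementaryMinorOf H
  deleteEdge   : ∀ e → EdgeDeletion   H e G → G IsElementaryMinorOf H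
  contractEdge : ∀ e → Contraction    H e G → G IsElementaryMinorOf H

_IsMinorOf_ : Graph → Graph → Set
G IsMinorOf H = Star (flip _IsElementaryMinorOf_) H G

IsSpectatorFloor : Graph → ℕ → Set
IsSpectatorFloor G = IsMinimum λ s → ∃[ H ] (G IsMinorOf H × IsSpectatorNumber H s)

SameSpectatorFloor : Graph → Graph → Set
SameSpectatorFloor G H = ∃[ s ] (IsSpectatorFloor G s × IsSpectatorFloor H s)

ContractingReducesDiameter : (G : Graph) → Edge G → Set
ContractingReducesDiameter G e =
  ∃[ G′ ] ∃[ d ] ∃[ d′ ]
    (Contraction G e G′ × IsDiameter G d × IsDiameter G′ d′ × d′ < d)

{-# OPTIONS --safe #-}
module Submission where

-- Every path of a tree T is a unique shortest path, so sp(T) = |T| − diam T − 1.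
-- This is also the spectator floor, and more generally |G| ≤ diam G + 1 + sp(H)
-- whenever a connected graph G is a minor of H: let P be a parade of H, and
-- replace the part of P between its first and last vertex lying in a branch
-- set by a walk through the branch sets of a geodesic of G.  The new walk has
-- at least |P| vertices and meets at most diam G + 1 branch sets; each other
-- vertex of G has a branch set off the walk, so there are at most
-- |H| − |P| = sp(H) of them.
--
-- Hence contracting e preserves the floor exactly when it lowers the diameter.
-- If deleting e preserves the floor, take a geodesic of T / e.  Either it lifts
-- to a path of T through e, or its lift R avoids e; in the second case joining
-- an end of R to the other component of T − e gives a tree on |T| vertices with
-- T − e as a minor and a path longer than R, and its spectator number bounds
-- the floor.  Either way diam T > diam (T / e).

open import Defs
open import Data.Fin using (Fin; zero; suc; punchIn; punchOut; _≟_)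
open import Data.Fin.Permutation using (↔⇒≡)
open import Data.Fin.Properties
  using (punchIn-injective; punchInᵢ≢i; punchIn-punchOut; suc-injective)
open import Data.List
  using (List; []; _∷_; _++_; [_]; length; map; filter; allFin; cartesianProduct)
open import Data.List.Extrema.Nat using (argmax; f[xs]≤f[argmax])
open import Data.List.Membership.Propositional using (_∈_; _∉_)
open import Data.List.Membership.Propositional.Properties
  using (∈-map⁺; ∈-map⁻; ∈-++⁺ˡ; ∈-++⁺ʳ; ∈-++⁻; ∈-∃++; ∈-allFin;
         ∈-filter⁺; ∈-filter⁻; ∈-cartesianProduct⁺)
open import Data.List.Properties using (length-++; length-map; length-tabulate; map-id)
open import Data.List.Relation.Binary.Subset.Propositional using (_⊆_)
open import Data.List.Relation.Unary.All as All using (All; []; _∷_)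
open import Data.List.Relation.Unary.AllPairs using ([]; _∷_)
open import Data.List.Relation.Unary.Any using (here; there)
open import Data.List.Relation.Unary.Unique.Propositional using (Unique)
import Data.List.Relation.Unary.Unique.Propositional.Properties as Unique
open import Data.Maybe using (Maybe; just; nothing; _>>=_)
open import Data.Maybe.Properties using (just-injective)
open import Data.Nat using (ℕ; zero; suc; _+_; _∸_; _≤_; _<_; z≤n; s≤s)
import Data.Nat.Properties as ℕ using (suc-injective)
open import Data.Nat.Properties hiding (_≟_; suc-injective)
open import Data.Product using (Σ-syntax; ∃-syntax; _×_; _,_; proj₁; proj₂)
open import Data.Product.Properties using (,-injectiveˡ; ,-injectiveʳ)
open import Data.Sum using (_⊎_; inj₁; inj₂; swap; map₁)
open import Function using (_⇔_; mk⇔; _∘_; id; Inverse)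
open import Function.Construct.Identity using (↔-id)
open import Relation.Binary.Construct.Closure.ReflexiveTransitive using (ε; _◅_)
open import Relation.Binary.PropositionalEquality
  using (_≡_; _≢_; refl; sym; trans; cong; cong₂; subst; subst₂)
open import Relation.Nullary using (¬_; yes; no; contradiction)

import Data.List.Membership.DecPropositional as DecMembership
open module FinMembership {n} = DecMembership (_≟_ {n}) using (_∈?_; _∉?_)

-- Counting with duplicate-free lists

unique-⊆⇒length≤ : ∀ {A : Set} {xs ys : List A} → Unique xs → xs ⊆ ys → length xs ≤ length ys
unique-⊆⇒length≤ [] _ = z≤n
unique-⊆⇒length≤ {xs = x ∷ xs} (x# ∷ xs!) sub with ∈-∃++ (sub (here refl))
... | as , bs , refl = begin
    suc (length xs)             ≤⟨ s≤s (unique-⊆⇒length≤ xs! sub′) ⟩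
    suc (length (as ++ bs))     ≡⟨ cong suc (length-++ as) ⟩
    suc (length as + length bs) ≡⟨ sym (+-suc (length as) (length bs)) ⟩
    length as + suc (length bs) ≡⟨ sym (length-++ as) ⟩
    length (as ++ x ∷ bs)       ∎
  where
  open ≤-Reasoning
  -- Cutting one occurrence of `x` out of the larger list loses nothing that `xs` uses, because `x`
  -- does not recur in `xs`.
  sub′ : xs ⊆ as ++ bs
  sub′ z∈ with ∈-++⁻ as (sub (there z∈))
  ... | inj₁ z∈as         = ∈-++⁺ˡ z∈as
  ... | inj₂ (here refl)  = contradiction refl (All.lookup x# z∈)
  ... | inj₂ (there z∈bs) = ∈-++⁺ʳ as z∈bs

length-allFin : ∀ n → length (allFin n) ≡ n
length-allFin n = length-tabulate id

unique⇒length≤ : ∀ {n} {xs : List (Fin n)} → Unique xs → length xs ≤ n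
unique⇒length≤ {n} {xs} xs! =
  subst (length xs ≤_) (length-allFin n) (unique-⊆⇒length≤ xs! (λ {x} _ → ∈-allFin x))

covering⇒≤length : ∀ {n} {xs : List (Fin n)} → (∀ x → x ∈ xs) → n ≤ length xs
covering⇒≤length {n} {xs} all∈ =
  subst (_≤ length xs) (length-allFin n) (unique-⊆⇒length≤ (Unique.allFin⁺ n) (λ {x} _ → all∈ x))

module _ {m n} {i : Fin n} {f : Fin m → Fin n} (all-but : EnumeratesAllBut i f) where
  open EnumeratesAllBut all-but

  -- The list of `i` followed by the values of `f` contains every element of `Fin n` exactly once.
  allBut⇒size : n ≡ suc m
  allBut⇒size = ≤-antisym
    (subst (n ≤_) len (covering⇒≤length all∈))
    (subst (_≤ n) len (unique⇒length≤ uniq))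
    where
    L = i ∷ map f (allFin m)
    len : length L ≡ suc m
    len = cong suc (trans (length-map f (allFin m)) (length-allFin m))
    all∈ : ∀ x → x ∈ L
    all∈ x with x ≟ i
    ... | yes x≡i = here x≡i
    ... | no x≢i with covers x x≢i
    ...   | j , refl = there (∈-map⁺ f (∈-allFin j))
    uniq : Unique L
    uniq = All.tabulate (λ z∈ i≡z → let j , _ , z≡fj = ∈-map⁻ f z∈ in
                           avoids j (sym (trans i≡z z≡fj)))
           ∷ Unique.map⁺ injective (Unique.allFin⁺ m)

skip : ∀ {n} (i : Fin n) → ∃[ m ] ∃[ f ] EnumeratesAllBut {m} i f
skip {suc n} i = n , punchIn i , record
  { injective = λ {j} {k} → punchIn-injective i j k
  ; avoids    = λ j → punchInᵢ≢i i j
  ; covers    = λ x x≢i → punchOut (x≢i ∘ sym) , punchIn-punchOut (x≢i ∘ sym)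
  }

maximiser : ∀ {n} → Fin n → (f : Fin n × Fin n → ℕ) → ∃[ p ] (∀ x y → f (x , y) ≤ f p)
maximiser {n} o f =
  argmax f (o , o) pairs , λ x y →
    All.lookup (f[xs]≤f[argmax] {f = f} (o , o) pairs)
               (∈-cartesianProduct⁺ (∈-allFin x) (∈-allFin y))
  where pairs = cartesianProduct (allFin n) (allFin n)

-- Walks, and paths extracted from them

module _ {G : Graph} where

  joins-unique : ∀ {e x y z} → Joins G e x y → Joins G e x z → y ≡ z
  joins-unique (inj₁ p) (inj₁ q) = ,-injectiveʳ (trans (sym p) q)
  joins-unique (inj₁ p) (inj₂ q) =
    trans (,-injectiveʳ (trans (sym p) q)) (,-injectiveˡ (trans (sym p) q))
  joins-unique (inj₂ p) (inj₁ q) =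
    trans (,-injectiveˡ (trans (sym p) q)) (,-injectiveʳ (trans (sym p) q))
  joins-unique (inj₂ p) (inj₂ q) = ,-injectiveˡ (trans (sym p) q)

  sameEnds : ∀ {e x y a b} → Joins G e x y → Joins G e a b →
             (x ≡ a × y ≡ b) ⊎ (x ≡ b × y ≡ a)
  sameEnds (inj₁ p) (inj₁ q) with refl ← trans (sym p) q = inj₁ (refl , refl)
  sameEnds (inj₁ p) (inj₂ q) with refl ← trans (sym p) q = inj₂ (refl , refl)
  sameEnds (inj₂ p) (inj₁ q) with refl ← trans (sym p) q = inj₂ (refl , refl)
  sameEnds (inj₂ p) (inj₂ q) with refl ← trans (sym p) q = inj₁ (refl , refl)

  joins⇒≢ : ∀ {e x y} → Joins G e x y → x ≢ y
  joins⇒≢ {e} {x} (inj₁ p) refl = loopless G e x p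
  joins⇒≢ {e} {x} (inj₂ p) refl = loopless G e x p

  infixr 5 _⊕_
  _⊕_ : ∀ {u v w} → Walk G u v → Walk G v w → Walk G u w
  stop       ⊕ w′ = w′
  step e j w ⊕ w′ = step e j (w ⊕ w′)

  reverse : ∀ {u v} → Walk G u v → Walk G v u
  reverse stop         = stop
  reverse (step e j w) = reverse w ⊕ step e (swap j) stop

  edges-⊕⁻ : ∀ {u v w e} (p : Walk G u v) {q : Walk G v w} →
             e ∈ edges G (p ⊕ q) → e ∈ edges G p ⊎ e ∈ edges G q
  edges-⊕⁻ stop         e∈         = inj₂ e∈
  edges-⊕⁻ (step f j p) (here eq)  = inj₁ (here eq)
  edges-⊕⁻ (step f j p) (there e∈) with edges-⊕⁻ p e∈
  ... | inj₁ e∈p = inj₁ (there e∈p)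
  ... | inj₂ e∈q = inj₂ e∈q

  vertices-⊕⁻ : ∀ {u v w x} (p : Walk G u v) {q : Walk G v w} →
                x ∈ vertices G (p ⊕ q) → x ∈ vertices G p ⊎ x ∈ vertices G q
  vertices-⊕⁻ stop         x∈         = inj₂ x∈
  vertices-⊕⁻ (step f j p) (here eq)  = inj₁ (here eq)
  vertices-⊕⁻ (step f j p) (there x∈) with vertices-⊕⁻ p x∈
  ... | inj₁ x∈p = inj₁ (there x∈p)
  ... | inj₂ x∈q = inj₂ x∈q

  edges-reverse⁻ : ∀ {u v e} (p : Walk G u v) → e ∈ edges G (reverse p) → e ∈ edges G p
  edges-reverse⁻ (step f j p) e∈ with edges-⊕⁻ (reverse p) e∈
  ... | inj₁ e∈p       = there (edges-reverse⁻ p e∈p)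
  ... | inj₂ (here eq) = here eq

  length-vertices : ∀ {u v} (w : Walk G u v) → length (vertices G w) ≡ suc (length (edges G w))
  length-vertices stop         = refl
  length-vertices (step e j w) = cong suc (length-vertices w)

  start∈ : ∀ {u v} (w : Walk G u v) → u ∈ vertices G w
  start∈ stop         = here refl
  start∈ (step e j w) = here refl

  end∈ : ∀ {u v} (w : Walk G u v) → v ∈ vertices G w
  end∈ stop         = here refl
  end∈ (step e j w) = there (end∈ w)

  edge⇒vertex : ∀ {u v e x y} (w : Walk G u v) → e ∈ edges G w → Joins G e x y → x ∈ vertices G w
  edge⇒vertex (step f j w) (here refl) j′ with sameEnds j′ j
  ... | inj₁ (refl , _) = here refl
  ... | inj₂ (refl , _) = there (start∈ w)
  edge⇒vertex (step f j w) (there e∈) j′ = there (edge⇒vertex w e∈ j′)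

  prefix : ∀ {u v x} (w : Walk G u v) → x ∈ vertices G w → Walk G u x
  prefix stop         (here refl) = stop
  prefix (step e j w) (here refl) = stop
  prefix (step e j w) (there x∈)  = step e j (prefix w x∈)

  -- The path may start at a vertex `u` other than the start `x` of `w`, so one record serves both
  -- `suffix` and `erase`. The edge bound is for bridge arguments, the vertex bound for tracking
  -- branch sets, the length bound for distances.
  record Shortcut {u v x} (w : Walk G x v) : Set where
    field
      path     : Path G u v
      edges⊆   : pathEdges G path ⊆ edges G w
      vertices⊆ : vertices G (proj₁ path) ⊆ vertices G w
      shorter  : pathLength G path ≤ length (edges G w)
  open Shortcut public

  suffix : ∀ {u v x} (w : Walk G u v) → Unique (vertices G w) → x ∈ vertices G w →
           Shortcut {x} w
  suffix stop u (here refl) = record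
    { path = stop , u ; edges⊆ = id ; vertices⊆ = id ; shorter = ≤-refl }
  suffix w@(step _ _ _) u (here refl) = record
    { path = w , u ; edges⊆ = id ; vertices⊆ = id ; shorter = ≤-refl }
  suffix (step e j w) (_ ∷ u) (there x∈) = record
    { path      = path S
    ; edges⊆    = there ∘ edges⊆ S
    ; vertices⊆ = there ∘ vertices⊆ S
    ; shorter   = m≤n⇒m≤1+n (shorter S)
    } where S = suffix w u x∈

  -- The tail is made a path first. If `u` already lies on it, the suffix from that occurrence is
  -- the path sought; otherwise the first edge is put back in front.
  erase : ∀ {u v} (w : Walk G u v) → Shortcut {u} w
  erase stop = record
    { path = stop , [] ∷ [] ; edges⊆ = id ; vertices⊆ = id ; shorter = z≤n }
  erase {u} (step e j w) with erase w
  ... | S with u ∈? vertices G (proj₁ (path S))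
  ...   | yes u∈ = record
    { path      = path S′
    ; edges⊆    = there ∘ edges⊆ S ∘ edges⊆ S′
    ; vertices⊆ = there ∘ vertices⊆ S ∘ vertices⊆ S′
    ; shorter   = m≤n⇒m≤1+n (≤-trans (shorter S′) (shorter S))
    } where S′ = suffix (proj₁ (path S)) (proj₂ (path S)) u∈
  ...   | no u∉ = record
    { path = step e j (proj₁ (path S))
           , All.tabulate (λ {z} z∈ u≡z → u∉ (subst (_∈ _) (sym u≡z) z∈)) ∷ proj₂ (path S)
    ; edges⊆    = λ { (here eq) → here eq ; (there e∈) → there (edges⊆ S e∈) }
    ; vertices⊆ = λ { (here eq) → here eq ; (there x∈) → there (vertices⊆ S x∈) }
    ; shorter   = s≤s (shorter S)
    }

-- Acyclicity and uniqueness of paths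

-- Acyclicity restated for walks, which can be concatenated, lifted and projected without restoring
-- distinctness of their vertices each time.
AllBridges : Graph → Set
AllBridges G = ∀ {e x y} → Joins G e x y → (w : Walk G x y) → e ∈ edges G w

module _ {G : Graph} where

  acyclic⇒allBridges : ¬ Cycle G → AllBridges G
  acyclic⇒allBridges acyclic {e} {x} {y} j w with e ∈? edges G w
  ... | yes e∈ = e∈
  ... | no e∉  = contradiction
    (x , y , path S , e , j , e∉ ∘ edges⊆ S) acyclic
    where S = erase w

  allBridges⇒acyclic : AllBridges G → ¬ Cycle G
  allBridges⇒acyclic bridge (u , v , (w , _) , e , j , e∉) = e∉ (bridge j w)

  allBridges⇒noParallel : AllBridges G → ∀ e → HasNoParallel G e
  allBridges⇒noParallel bridge e f x y je jf with bridge je (step f jf stop)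
  ... | here eq = sym eq

  closedPath-trivial : ∀ {u} (w : Walk G u u) → Unique (vertices G w) → edges G w ≡ []
  closedPath-trivial stop         _        = refl
  closedPath-trivial (step e j w) (u# ∷ _) = contradiction refl (All.lookup u# (end∈ w))

  -- If the first edges e and f differ, the two tails give a walk between the
  -- ends of e that avoids e.
  pathEdges-unique : AllBridges G → ∀ {u v} (p : Walk G u v) → Unique (vertices G p) →
                     (q : Walk G u v) → Unique (vertices G q) → edges G p ≡ edges G q
  pathEdges-unique _ stop _ q q! = sym (closedPath-trivial q q!)
  pathEdges-unique _ p@(step _ _ _) p! stop _ = closedPath-trivial p p!
  pathEdges-unique bridge (step e j p) (u# ∷ p!) (step f k q) (u#′ ∷ q!) with e ≟ f
  pathEdges-unique bridge (step e j p) (u# ∷ p!) (step {y = y} e k q) (u#′ ∷ q!) | yes refl =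
    cong (e ∷_) (tails (joins-unique {G} j k) p p!)
    where
    tails : ∀ {x} → x ≡ y → (p : Walk G x _) → Unique (vertices G p) → edges G p ≡ edges G q
    tails refl p p! = pathEdges-unique bridge p p! q q!
  pathEdges-unique bridge (step e j p) (u# ∷ p!) (step f k q) (u#′ ∷ q!) | no e≢f
    with edges-⊕⁻ p (bridge (swap j) (p ⊕ reverse (step f k q)))
  ... | inj₁ e∈ = contradiction refl (All.lookup u# (edge⇒vertex p e∈ j))
  ... | inj₂ e∈ with edges-reverse⁻ (step f k q) e∈
  ...   | here eq   = contradiction eq e≢f
  ...   | there e∈q = contradiction refl (All.lookup u#′ (edge⇒vertex q e∈q j))

-- Distance, diameter and spectator number of a tree

module Tree {G : Graph} (tree : IsTree G) where
  open IsTree tree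

  bridges : AllBridges G
  bridges = acyclic⇒allBridges acyclic

  samePathEdges : ∀ {u v} (P Q : Path G u v) → pathEdges G P ≡ pathEdges G Q
  samePathEdges (p , p!) (q , q!) = pathEdges-unique bridges p p! q q!

  -- Measured on the path that `connected` happens to supply; by uniqueness of paths any other
  -- choice has the same length.
  distance : Vertex G → Vertex G → ℕ
  distance u v = pathLength G (connected u v)

  pathLength≡distance : ∀ {u v} (P : Path G u v) → pathLength G P ≡ distance u v
  pathLength≡distance P = cong length (samePathEdges P (connected _ _))

  isDistance : ∀ u v → IsDistance G u v (distance u v)
  isDistance u v = (connected u v , refl) ,
    λ { j (P , refl) → ≤-reflexive (sym (pathLength≡distance P)) }

  distance≤walk : ∀ {u v} (w : Walk G u v) → distance u v ≤ length (edges G w)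
  distance≤walk w = subst (_≤ _) (pathLength≡distance (path S)) (shorter S)
    where S = erase w

  abstract
    diameter : ∃[ d ] IsDiameter G d
    diameter with maximiser nonEmpty (λ (u , v) → distance u v)
    ... | (u , v) , max = distance u v , connected , (u , v , isDistance u v) ,
      λ { j (x , y , (P , refl) , _) → subst (_≤ _) (sym (pathLength≡distance P)) (max x y) }

  isUniqueShortest : ∀ {u v} (P : Path G u v) → IsUniqueShortest G P
  isUniqueShortest P =
    (λ Q → ≤-reflexive (cong length (samePathEdges P Q))) ,
    (λ Q _ → samePathEdges Q P)

  module _ {d} (isDiam : IsDiameter G d) where

    distance≤diameter : ∀ u v → distance u v ≤ d
    distance≤diameter u v = proj₂ (proj₂ isDiam) _ (u , v , isDistance u v)

    pathLength≤diameter : ∀ {u v} (P : Path G u v) → pathLength G P ≤ d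
    pathLength≤diameter P =
      subst (_≤ d) (sym (pathLength≡distance P)) (distance≤diameter _ _)

    diametralPath : ∃[ u ] ∃[ v ] Σ[ P ∈ Path G u v ] pathLength G P ≡ d
    diametralPath with proj₁ (proj₂ isDiam)
    ... | u , v , (P , eq) , _ = u , v , P , eq

    parade : IsParadeNumber G (suc d)
    parade with diametralPath
    ... | u , v , P , refl =
      (u , v , P , isUniqueShortest P , length-vertices (proj₁ P)) ,
      λ { j (x , y , Q , _ , refl) →
          subst (_≤ suc d) (sym (length-vertices (proj₁ Q))) (s≤s (pathLength≤diameter Q)) }

    spectator : ∃[ s ] (s + suc d ≡ order G × IsSpectatorNumber G s)
    spectator = order G ∸ suc d , eq , suc d , parade , eq
      where
      -- The truncated subtraction is exact: a path with `d` edges has `d + 1` distinct vertices.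
      1+d≤n : suc d ≤ order G
      1+d≤n with diametralPath
      ... | u , v , (w , w!) , refl = subst (_≤ _) (length-vertices w) (unique⇒length≤ w!)
      eq = m∸n+n≡m 1+d≤n

-- Homomorphisms and minor models

record Hom (G H : Graph) : Set where
  field
    onVertices : Vertex G → Vertex H
    onEdges    : Edge G → Edge H
    onJoins    : ∀ f x y → Joins G f x y → Joins H (onEdges f) (onVertices x) (onVertices y)

  mapWalk : ∀ {u v} → Walk G u v → Walk H (onVertices u) (onVertices v)
  mapWalk stop         = stop
  mapWalk (step e j w) = step (onEdges e) (onJoins e _ _ j) (mapWalk w)

  vertices-map : ∀ {u v} (w : Walk G u v) →
                 vertices H (mapWalk w) ≡ map onVertices (vertices G w)
  vertices-map stop         = refl
  vertices-map (step e j w) = cong (_ ∷_) (vertices-map w)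

  edges-map : ∀ {u v} (w : Walk G u v) → edges H (mapWalk w) ≡ map onEdges (edges G w)
  edges-map stop         = refl
  edges-map (step e j w) = cong (_ ∷_) (edges-map w)

-- A minor model: φ sends each vertex of H to the vertex of G whose branch set
-- contains it, if any.
record Model (G H : Graph) : Set where
  field
    φ    : Vertex H → Maybe (Vertex G)
    onto : ∀ x → ∃[ a ] φ a ≡ just x
    lift : ∀ {x y a b} (w : Walk G x y) → φ a ≡ just x → φ b ≡ just y →
           Σ[ w′ ∈ Walk H a b ] (∀ {z} → z ∈ vertices H w′ →
                                 ∃[ t ] (φ z ≡ just t × t ∈ vertices G w))

composeModels : ∀ {G K H} → Model G K → Model K H → Model G H
composeModels {G} {K} {H} M N = record { φ = φ ; onto = onto ; lift = lift }
  where
  module M = Model M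
  module N = Model N
  φ : Vertex H → Maybe (Vertex G)
  φ a = N.φ a >>= M.φ
  split : ∀ {a x} → φ a ≡ just x → ∃[ k ] (N.φ a ≡ just k × M.φ k ≡ just x)
  split {a} eq with N.φ a
  ... | just k = k , refl , eq
  join : ∀ {a k x} → N.φ a ≡ just k → M.φ k ≡ just x → φ a ≡ just x
  join eq eq′ rewrite eq = eq′
  onto : ∀ x → ∃[ a ] φ a ≡ just x
  onto x = let k , eq = M.onto x ; a , eq′ = N.onto k in a , join eq′ eq
  lift : ∀ {x y a b} (w : Walk G x y) → φ a ≡ just x → φ b ≡ just y →
         Σ[ w′ ∈ Walk H a b ] (∀ {z} → z ∈ vertices H w′ →
                               ∃[ t ] (φ z ≡ just t × t ∈ vertices G w))
  lift w eqa eqb =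
    let _ , na , ma = split eqa
        _ , nb , mb = split eqb
        w₁ , in₁ = M.lift w ma mb
        w₂ , in₂ = N.lift w₁ na nb
    in w₂ , λ z∈ → let k , nz , k∈ = in₂ z∈ ; t , mk , t∈ = in₁ k∈ in t , join nz mk , t∈

idModel : ∀ {G} → Model G G
idModel = record
  { φ = just
  ; onto = λ x → x , refl
  ; lift = λ { w refl refl → w , λ {z} z∈ → z , refl , z∈ }
  }

-- Common to both deletions: branch sets are singletons, `φ` is the partial inverse of `h`, and a
-- walk lifts to its image under `h`.
homModel : ∀ {G H} (h : Hom G H) (φ : Vertex H → Maybe (Vertex G)) →
           (∀ x → φ (Hom.onVertices h x) ≡ just x) →
           (∀ {a x} → φ a ≡ just x → a ≡ Hom.onVertices h x) → Model G H
homModel {G} {H} h φ φ-on on-φ = record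
  { φ    = φ
  ; onto = λ x → onVertices x , φ-on x
  ; lift = lift
  }
  where
  open Hom h
  lift : ∀ {x y a b} (w : Walk G x y) → φ a ≡ just x → φ b ≡ just y →
         Σ[ w′ ∈ Walk H a b ] (∀ {z} → z ∈ vertices H w′ →
                               ∃[ t ] (φ z ≡ just t × t ∈ vertices G w))
  lift w eqa eqb with refl ← on-φ eqa | refl ← on-φ eqb = mapWalk w , λ {z} z∈ →
    let t , t∈ , z≡ = ∈-map⁻ onVertices (subst (z ∈_) (vertices-map w) z∈)
    in t , trans (cong φ z≡) (φ-on t) , t∈

vertexDeletionModel : ∀ {G H v} → VertexDeletion H v G → Model G H
vertexDeletionModel {G} {H} {v} D = homModel h φ φ-on on-φ
  where
  open VertexDeletion D
  open EnumeratesAllBut vertexMap-all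
  h : Hom G H
  h = record { onVertices = vertexMap ; onEdges = Inverse.to edgeMap ; onJoins = preservesJoins }
  φ : Vertex H → Maybe (Vertex G)
  φ a with a ≟ v
  ... | yes _   = nothing
  ... | no a≢v = just (proj₁ (covers a a≢v))
  φ-on : ∀ x → φ (vertexMap x) ≡ just x
  φ-on x with vertexMap x ≟ v
  ... | yes eq  = contradiction eq (avoids x)
  ... | no neq = cong just (injective (proj₂ (covers (vertexMap x) neq)))
  on-φ : ∀ {a x} → φ a ≡ just x → a ≡ vertexMap x
  on-φ {a} eq with a ≟ v
  on-φ {a} refl | no a≢v = sym (proj₂ (covers a a≢v))

module _ {G H : Graph} {e : Edge H} (D : EdgeDeletion H e G) where
  open EdgeDeletion D

  edgeDeletionHom : Hom G H
  edgeDeletionHom = record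
    { onVertices = Inverse.to vertexMap ; onEdges = edgeMap ; onJoins = preservesJoins }

  edgeDeletionModel : Model G H
  edgeDeletionModel = homModel edgeDeletionHom (just ∘ Inverse.from vertexMap)
    (λ x → cong just (Inverse.strictlyInverseʳ vertexMap x))
    (λ { {a} refl → sym (Inverse.strictlyInverseˡ vertexMap a) })

-- Walks and trees under contraction

module ContractionWalks {G H : Graph} {e : Edge H} (C : Contraction H e G) where
  open Contraction C
  open EnumeratesAllBut edgeMap-all

  -- Two vertices of one fibre are equal or are the ends of `e`, so at most the edge `e` is
  -- travelled.
  fibreWalk : ∀ a b → vertexMap a ≡ vertexMap b →
              Σ[ w ∈ Walk H a b ] (edges H w ⊆ [ e ] ×
                (∀ {z} → z ∈ vertices H w → vertexMap z ≡ vertexMap b))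
  fibreWalk a b eq with separates a b eq
  ... | inj₁ refl = stop , (λ ()) , λ { (here refl) → refl }
  ... | inj₂ j    = step e j stop , (λ { (here refl) → here refl }) ,
                    λ { (here refl) → eq ; (there (here refl)) → refl }

  -- The stored order of the ends of `edgeMap f` may run against the direction from `x` to `y`; `p`
  -- and `q` are those ends, ordered to match.
  edgeLift : ∀ {f x y} → Joins G f x y →
             ∃[ p ] ∃[ q ] (Joins H (edgeMap f) p q × vertexMap p ≡ x × vertexMap q ≡ y)
  edgeLift {f} j with sameEnds {G} j (preservesJoins f _ _ (inj₁ refl))
  ... | inj₁ (eqx , eqy) = _ , _ , inj₁ refl , sym eqx , sym eqy
  ... | inj₂ (eqx , eqy) = _ , _ , inj₂ refl , sym eqx , sym eqy

  -- Consecutive lifted edges need only meet in a common fibre; the gaps are closed by fibre walks,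
  -- which add no edge except `e`. The edge bound serves `contraction-isTree`, the vertex bound
  -- `contractionModel`.
  liftWalk : ∀ {x y a b} (w : Walk G x y) → vertexMap a ≡ x → vertexMap b ≡ y →
             Σ[ w′ ∈ Walk H a b ] (edges H w′ ⊆ e ∷ map edgeMap (edges G w) ×
               (∀ {z} → z ∈ vertices H w′ → vertexMap z ∈ vertices G w))
  liftWalk {a = a} {b} stop refl eqb with fibreWalk a b (sym eqb)
  ... | w , es , vs = w , es , λ z∈ → here (trans (vs z∈) eqb)
  liftWalk {a = a} (step f j w) refl eqb with edgeLift j
  ... | p , q , j′ , eqp , eqq with fibreWalk a p (sym eqp) | liftWalk w eqq eqb
  ...   | w₁ , es₁ , vs₁ | w₂ , es₂ , vs₂ = w₁ ⊕ step (edgeMap f) j′ w₂ , es , vs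
    where
    es : edges H (w₁ ⊕ step (edgeMap f) j′ w₂) ⊆ e ∷ map edgeMap (f ∷ edges G w)
    es g∈ with edges-⊕⁻ w₁ g∈
    ... | inj₁ g∈₁ with es₁ g∈₁
    ...   | here refl = here refl
    es g∈ | inj₂ (here refl) = there (here refl)
    es g∈ | inj₂ (there g∈₂) with es₂ g∈₂
    ...   | here refl  = here refl
    ...   | there g∈₂′ = there (there g∈₂′)
    vs : ∀ {z} → z ∈ vertices H (w₁ ⊕ step (edgeMap f) j′ w₂) →
         vertexMap z ∈ vertexMap a ∷ vertices G w
    vs z∈ with vertices-⊕⁻ w₁ z∈
    ... | inj₁ z∈₁         = here (trans (vs₁ z∈₁) eqp)
    ... | inj₂ (here refl) = here eqp
    ... | inj₂ (there z∈₂) = there (vs₂ z∈₂)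

  contractionModel : Model G H
  contractionModel = record
    { φ    = just ∘ vertexMap
    ; onto = λ x → let a , eq = surjective x in a , cong just eq
    ; lift = λ w eqa eqb →
        let w′ , _ , vs = liftWalk w (just-injective eqa) (just-injective eqb)
        in w′ , λ {z} z∈ → vertexMap z , refl , vs z∈
    }

  -- Steps along `e` are dropped, since its ends become one vertex; all other steps survive. Hence
  -- each use of `e` makes the projection strictly shorter.
  projectWalk : ∀ {a b} (w : Walk H a b) →
                Σ[ w′ ∈ Walk G (vertexMap a) (vertexMap b) ]
                  (length (edges G w′) ≤ length (edges H w) ×
                   (e ∈ edges H w → length (edges G w′) < length (edges H w)))
  projectWalk stop = stop , z≤n , λ ()
  projectWalk {b = b} (step {y = y} f j w) with projectWalk w | f ≟ e
  ... | w′ , l , _ | yes refl = subst (λ x → Walk G x (vertexMap b)) eq w′ ,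
    m≤n⇒m≤1+n (subst (_≤ _) (len eq) l) , λ _ → s≤s (subst (_≤ _) (len eq) l)
    where
    eq = sym (identifies _ _ j)
    len : ∀ {x} (eq : vertexMap y ≡ x) →
          length (edges G w′) ≡ length (edges G (subst (λ x → Walk G x (vertexMap b)) eq w′))
    len refl = refl
  ... | w′ , l , l′ | no f≢e with EnumeratesAllBut.covers edgeMap-all f f≢e
  ...   | g , refl = step g (preservesJoins g _ _ j) w′ , s≤s l ,
                     λ { (here eq) → contradiction (sym eq) f≢e ; (there e∈) → s≤s (l′ e∈) }

  -- Only the fibre {p, q} over the contracted edge is not a singleton, so a
  -- section of vertexMap avoiding q misses nothing else.
  contraction-order : order H ≡ suc (order G)
  contraction-order with ends H e in eq
  ... | p , q = allBut⇒size {i = q} {f = proj₁ ∘ section} record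
    { injective = λ {x} {y} s≡ →
        trans (sym (section-eq x)) (trans (cong vertexMap s≡) (section-eq y))
    ; avoids = λ x → section-avoids x
    ; covers = λ a a≢q → vertexMap a , section-covers a a≢q }
    where
    e-pq : Joins H e p q
    e-pq = inj₁ eq
    section : ∀ x → ∃[ a ] (vertexMap a ≡ x × a ≢ q)
    section x with surjective x
    ... | a , eqa with a ≟ q
    ...   | yes refl = p , trans (identifies _ _ e-pq) eqa , joins⇒≢ {H} e-pq
    ...   | no a≢q   = a , eqa , a≢q
    section-eq : ∀ x → vertexMap (proj₁ (section x)) ≡ x
    section-eq x = proj₁ (proj₂ (section x))
    section-avoids : ∀ x → proj₁ (section x) ≢ q
    section-avoids x = proj₂ (proj₂ (section x))
    section-covers : ∀ a → a ≢ q → proj₁ (section (vertexMap a)) ≡ a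
    section-covers a a≢q with separates _ a (section-eq (vertexMap a))
    ... | inj₁ same = same
    ... | inj₂ j with sameEnds {H} j e-pq
    ...   | inj₁ (_ , a≡q) = contradiction a≡q a≢q
    ...   | inj₂ (s≡q , _) = contradiction s≡q (section-avoids (vertexMap a))

  -- Connecting walks are projected from `H`. For bridges, a walk of `G` is lifted to `H`, where it
  -- must use `edgeMap f`; the lift adds only `e`, which is outside the image of `edgeMap`, so `f`
  -- was on the original walk.
  contraction-isTree : IsTree H → IsTree G
  contraction-isTree tree = record
    { nonEmpty  = vertexMap nonEmpty
    ; connected = conn
    ; acyclic   = allBridges⇒acyclic bridge
    }
    where
    open IsTree tree
    open Tree tree using (bridges)
    conn : Connected G
    conn x y with surjective x | surjective y
    ... | a , refl | b , refl = path (erase (proj₁ (projectWalk (proj₁ (connected a b)))))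
    bridge : AllBridges G
    bridge {f} j w with edgeLift j
    ... | p , q , j′ , eqp , eqq with liftWalk w eqp eqq
    ...   | w′ , es , _ with es (bridges j′ w′)
    ...     | here eq   = contradiction eq (avoids f)
    ...     | there f∈ with ∈-map⁻ edgeMap f∈
    ...       | g , g∈ , eq with refl ← injective eq = g∈

elementaryModel : ∀ {G H} → G IsElementaryMinorOf H → Model G H
elementaryModel (deleteVertex _ D) = vertexDeletionModel D
elementaryModel (deleteEdge   _ D) = edgeDeletionModel D
elementaryModel (contractEdge _ C) = ContractionWalks.contractionModel C

minorModel : ∀ {G H} → G IsMinorOf H → Model G H
minorModel ε       = idModel
minorModel (m ◅ ms) = composeModels (minorModel ms) (elementaryModel m)

-- Rerouting a parade through a geodesic of the minor

module _ {G H : Graph} (M : Model G H) where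
  open Model M

  -- In the second case a and b are the first and last vertices of w that lie
  -- in branch sets.
  data Ends {u v} (w : Walk H u v) : Set where
    unused : (∀ {z} → z ∈ vertices H w → φ z ≡ nothing) → Ends w
    used   : ∀ {a b x y} → φ a ≡ just x → φ b ≡ just y →
             (w₁ : Walk H u a) → (∀ {z t} → z ∈ vertices H w₁ → φ z ≡ just t → t ≡ x) →
             (w₂ : Walk H b v) → (∀ {z t} → z ∈ vertices H w₂ → φ z ≡ just t → t ≡ y) →
             Ends w

  ends-of : ∀ {u v} (w : Walk H u v) → Ends w
  ends-of {u} stop with φ u in eq
  ... | nothing = unused λ { (here refl) → eq }
  ... | just x  = used eq eq stop only stop only
    where
    only : ∀ {z t} → z ∈ [ u ] → φ z ≡ just t → t ≡ x
    only (here refl) eq′ = just-injective (trans (sym eq′) eq)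
  ends-of {u} w@(step e j w′) with φ u in eq | ends-of w′
  ... | nothing | unused none = unused λ { (here refl) → eq ; (there z∈) → none z∈ }
  ... | nothing | used eqa eqb w₁ only₁ w₂ only₂ =
    used eqa eqb (step e j w₁)
      (λ { (here refl) eq′ → contradiction (trans (sym eq′) eq) λ ()
         ; (there z∈) eq′ → only₁ z∈ eq′ })
      w₂ only₂
  -- Here `u` alone lies in a branch set, so it is both the first and the last such vertex, and the
  -- final piece is the whole walk.
  ... | just x | unused none =
    used eq eq stop (λ { (here refl) eq′ → just-injective (trans (sym eq′) eq) })
      w (λ { (here refl) eq′ → just-injective (trans (sym eq′) eq)
           ; (there z∈) eq′ → contradiction (trans (sym eq′) (none z∈)) λ () })
  -- The new start replaces the first vertex found in the tail; the last one stays.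
  ... | just x | used _ eqb _ _ w₂ only₂ =
    used eq eqb stop (λ { (here refl) eq′ → just-injective (trans (sym eq′) eq) }) w₂ only₂

  module _ {d} (short : ∀ x y → Σ[ w ∈ Walk G x y ] length (edges G w) ≤ d) where

    -- The outer pieces meet only the branch sets of `x` and `y`, which are the ends of `m`, and the
    -- lift of `m` meets only branch sets of vertices of `m`. So `W` can be the vertex list of `m`,
    -- of length at most `d + 1`.
    reroute : ∀ {u v} → Walk H u v →
              Σ[ Q ∈ Walk H u v ] Σ[ W ∈ List (Vertex G) ] (length W ≤ suc d ×
                (∀ {z t} → z ∈ vertices H Q → φ z ≡ just t → t ∈ W))
    reroute w with ends-of w
    ... | unused none = w , [] , z≤n , λ z∈ eq → contradiction (trans (sym eq) (none z∈)) λ ()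
    ... | used {x = x} {y} eqa eqb w₁ only₁ w₂ only₂ =
      w₁ ⊕ m′ ⊕ w₂ , vertices G m , subst (_≤ _) (sym (length-vertices m)) (s≤s len) , tags
      where
      m = proj₁ (short x y)
      len = proj₂ (short x y)
      m′ = proj₁ (lift m eqa eqb)
      m′⊆ = proj₂ (lift m eqa eqb)
      x∈m : x ∈ vertices G m
      x∈m = start∈ m
      y∈m : y ∈ vertices G m
      y∈m = end∈ m
      tags : ∀ {z t} → z ∈ vertices H (w₁ ⊕ m′ ⊕ w₂) → φ z ≡ just t → t ∈ vertices G m
      tags z∈ eq with vertices-⊕⁻ w₁ z∈
      ... | inj₁ z∈₁ = subst (_∈ _) (sym (only₁ z∈₁ eq)) x∈m
      ... | inj₂ z∈′ with vertices-⊕⁻ m′ z∈′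
      ...   | inj₁ z∈m = let t′ , eq′ , t′∈ = m′⊆ z∈m in
                         subst (_∈ _) (just-injective (trans (sym eq′) eq)) t′∈
      ...   | inj₂ z∈₂ = subst (_∈ _) (sym (only₂ z∈₂ eq)) y∈m

    -- A vertex of G outside W has a branch set disjoint from Q, and Q has at
    -- least as many vertices as the parade.
    model⇒order≤ : ∀ {s} → IsSpectatorNumber H s → order G ≤ suc d + s
    model⇒order≤ {s} (_ , ((u , v , P , (shortest , _) , refl) , _) , s+k≡)
      with reroute (proj₁ P)
    ... | Q , W , |W|≤ , tags = begin
      order G                   ≤⟨ covering⇒≤length all∈ ⟩
      length (W ++ rest)        ≡⟨ length-++ W ⟩
      length W + length rest    ≤⟨ +-mono-≤ |W|≤ rest≤s ⟩
      suc d + s                 ∎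
      where
      open ≤-Reasoning
      S = erase Q
      VQ = vertices H (proj₁ (path S))
      rest = filter (_∉? W) (allFin (order G))
      all∈ : ∀ t → t ∈ W ++ rest
      all∈ t with t ∈? W
      ... | yes t∈ = ∈-++⁺ˡ t∈
      ... | no t∉  = ∈-++⁺ʳ W (∈-filter⁺ (_∉? W) (∈-allFin t) t∉)
      σ : Vertex G → Vertex H
      σ t = proj₁ (onto t)
      σ-injective : ∀ {t t′} → σ t ≡ σ t′ → t ≡ t′
      σ-injective {t} {t′} eq =
        just-injective (trans (sym (proj₂ (onto t))) (trans (cong φ eq) (proj₂ (onto t′))))
      uniq : Unique (map σ rest ++ VQ)
      uniq = Unique.++⁺
        (Unique.map⁺ σ-injective (Unique.filter⁺ (_∉? W) (Unique.allFin⁺ (order G))))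
        (proj₂ (path S))
        λ (z∈ , z∈Q) → let t , t∈ , z≡ = ∈-map⁻ σ z∈ in
          proj₂ (∈-filter⁻ (_∉? W) {xs = allFin (order G)} t∈)
                (tags (vertices⊆ S z∈Q) (trans (cong φ z≡) (proj₂ (onto t))))
      k = vertexCount H P
      k≤ : k ≤ length VQ
      k≤ = subst₂ _≤_ (sym (length-vertices (proj₁ P))) (sym (length-vertices (proj₁ (path S))))
                  (s≤s (shortest (path S)))
      rest≤s : length rest ≤ s
      rest≤s = +-cancelʳ-≤ k _ _ (begin
        length rest + k               ≤⟨ +-monoʳ-≤ (length rest) k≤ ⟩
        length rest + length VQ       ≡⟨ cong (_+ length VQ) (sym (length-map σ rest)) ⟩
        length (map σ rest) + length VQ ≡⟨ sym (length-++ (map σ rest)) ⟩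
        length (map σ rest ++ VQ)     ≤⟨ unique⇒length≤ uniq ⟩
        order H                       ≡⟨ sym s+k≡ ⟩
        s + k                         ∎)

-- Existence of contractions

-- The vertices of `G` stand for those of `H` other than the second end `q` of `e`; `retract` moves
-- `q` to the first end `p`.
contraction : ∀ {H} (e : Edge H) → HasNoParallel H e → ∃[ G ] Contraction H e G
contraction {H} e noPar with skip (proj₂ (ends H e)) | skip e
... | n , v , allV | m , ι , allE = G , record
  { noParallel     = noPar
  ; vertexMap      = vm
  ; surjective     = λ x → v x , V.injective (trans (v-vm (v x)) (retract-fixes (V.avoids x)))
  ; identifies     = λ x y j → cong-vm {x} {y} (identified x y j)
  ; separates      = λ x y → separates x y
  ; edgeMap        = ι
  ; edgeMap-all    = allE
  ; preservesJoins = λ { f x y (inj₁ eq) → inj₁ (cong (λ (a , b) → vm a , vm b) eq)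
                       ; f x y (inj₂ eq) → inj₂ (cong (λ (a , b) → vm a , vm b) eq) }
  }
  where
  module V = EnumeratesAllBut allV
  module E = EnumeratesAllBut allE
  p q : Vertex H
  p = proj₁ (ends H e)
  q = proj₂ (ends H e)
  e-pq : Joins H e p q
  e-pq = inj₁ refl
  p≢q : p ≢ q
  p≢q = joins⇒≢ {H} e-pq
  retract : Vertex H → Vertex H
  retract x with x ≟ q
  ... | yes _ = p
  ... | no _  = x
  retract-avoids : ∀ x → retract x ≢ q
  retract-avoids x with x ≟ q
  ... | yes _   = p≢q
  ... | no x≢q  = x≢q
  retract-fixes : ∀ {x} → x ≢ q → retract x ≡ x
  retract-fixes {x} x≢q with x ≟ q
  ... | yes x≡q = contradiction x≡q x≢q
  ... | no _    = refl
  retract-q : retract q ≡ p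
  retract-q with q ≟ q
  ... | yes _  = refl
  ... | no q≢q = contradiction refl q≢q
  vm : Vertex H → Fin n
  vm x = proj₁ (V.covers (retract x) (retract-avoids x))
  v-vm : ∀ x → v (vm x) ≡ retract x
  v-vm x = proj₂ (V.covers (retract x) (retract-avoids x))
  cong-vm : ∀ {x y} → retract x ≡ retract y → vm x ≡ vm y
  cong-vm {x} {y} eq = V.injective (trans (v-vm x) (trans eq (sym (v-vm y))))
  identified : ∀ x y → Joins H e x y → retract x ≡ retract y
  identified x y j with sameEnds {H} j e-pq
  ... | inj₁ (refl , refl) = trans (retract-fixes p≢q) (sym retract-q)
  ... | inj₂ (refl , refl) = trans retract-q (sym (retract-fixes p≢q))
  separates : ∀ x y → vm x ≡ vm y → (x ≡ y) ⊎ Joins H e x y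
  separates x y eq with x ≟ q | y ≟ q | trans (sym (v-vm x)) (trans (cong v eq) (v-vm y))
  ... | yes refl | yes refl | _    = inj₁ refl
  ... | yes refl | no _     | refl = inj₂ (swap e-pq)
  ... | no _     | yes refl | refl = inj₂ e-pq
  ... | no _     | no _     | refl = inj₁ refl
  G : Graph
  G = record
    { order    = n
    ; size     = m
    ; ends     = λ f → let a , b = ends H (ι f) in vm a , vm b
    ; loopless = λ f x eq → noLoop f
        (trans (cong proj₁ eq) (sym (cong proj₂ eq)))
    }
    where
    noLoop : ∀ f → vm (proj₁ (ends H (ι f))) ≢ vm (proj₂ (ends H (ι f)))
    -- A loop would come from a loop of `H` or from an edge parallel to `e`.
    noLoop f eq with separates _ _ eq
    ... | inj₁ a≡b = joins⇒≢ {H} {ι f} (inj₁ refl) a≡b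
    ... | inj₂ j   = E.avoids f (noPar (ι f) _ _ j (inj₁ refl))

-- Joining two components by a new edge

addEdge : (G : Graph) (a b : Vertex G) → a ≢ b → Graph
addEdge G a b a≢b = record
  { order    = order G
  ; size     = suc (size G)
  ; ends     = λ { zero → a , b ; (suc f) → ends G f }
  ; loopless = λ { zero x eq → a≢b (trans (,-injectiveˡ eq) (sym (,-injectiveʳ eq)))
                 ; (suc f) x eq → loopless G f x eq }
  }

module AddEdge (G : Graph) (a b : Vertex G) (a≢b : a ≢ b) where
  G⁺ : Graph
  G⁺ = addEdge G a b a≢b

  isEdgeDeletion : EdgeDeletion G⁺ zero G
  isEdgeDeletion = record
    { vertexMap      = ↔-id _
    ; edgeMap        = suc
    ; edgeMap-all    = record
      { injective = suc-injective
      ; avoids    = λ _ ()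
      ; covers    = λ { zero 0≢0 → contradiction refl 0≢0 ; (suc f) _ → f , refl }
      }
    ; preservesJoins = λ f x y j → j
    }

  open Hom (edgeDeletionHom isEdgeDeletion) public

  module _ (separated : ¬ Walk G a b) where

    Avoiding : Edge G → Vertex G → Vertex G → Set
    Avoiding f x y = Σ[ w ∈ Walk G x y ] f ∉ edges G w

    -- The walk is split at its last passage through the new edge.
    avoiding : ∀ f {x y} (w : Walk G⁺ x y) → suc f ∉ edges G⁺ w →
               Avoiding f x y ⊎ (Walk G x a × Avoiding f b y) ⊎ (Walk G x b × Avoiding f a y)
    avoiding f stop _ = inj₁ (stop , λ ())
    avoiding f (step (suc g) j w) f∉ with avoiding f w (f∉ ∘ there)
    ... | inj₁ (w′ , f∉′) = inj₁ (step g j w′ ,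
          λ { (here eq) → f∉ (here (cong suc eq)) ; (there f∈) → f∉′ f∈ })
    ... | inj₂ (inj₁ (l , r)) = inj₂ (inj₁ (step g j l , r))
    ... | inj₂ (inj₂ (l , r)) = inj₂ (inj₂ (step g j l , r))
    avoiding f (step zero (inj₁ refl) w) f∉ with avoiding f w (f∉ ∘ there)
    ... | inj₁ r              = inj₂ (inj₁ (stop , r))
    ... | inj₂ (inj₁ (l , _)) = contradiction (reverse l) separated
    -- The walk later crosses back to `a`, its own start, so the part after the last crossing
    -- suffices.
    ... | inj₂ (inj₂ (_ , r)) = inj₁ r
    avoiding f (step zero (inj₂ refl) w) f∉ with avoiding f w (f∉ ∘ there)
    ... | inj₁ r              = inj₂ (inj₂ (stop , r))
    ... | inj₂ (inj₁ (_ , r)) = inj₁ r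
    ... | inj₂ (inj₂ (l , _)) = contradiction l separated

    withoutNew : ∀ {x y} (w : Walk G⁺ x y) → zero ∉ edges G⁺ w → Walk G x y
    withoutNew stop               _  = stop
    withoutNew (step zero    j w) 0∉ = contradiction (here refl) 0∉
    withoutNew (step (suc g) j w) 0∉ = step g j (withoutNew w (0∉ ∘ there))

    -- A walk between `a` and `b` avoiding the new edge would lie in `G`. A walk between the ends of
    -- an old edge `f` avoiding `f` either lies in `G`, or leaves one end of `f` connected to `a`
    -- and the other to `b`, so that `f` itself would link `a` to `b`.
    addEdge-allBridges : AllBridges G → AllBridges G⁺
    addEdge-allBridges bridge {zero} j w with zero ∈? edges G⁺ w
    ... | yes 0∈ = 0∈
    addEdge-allBridges bridge {zero} (inj₁ refl) w | no 0∉ =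
      contradiction (withoutNew w 0∉) separated
    addEdge-allBridges bridge {zero} (inj₂ refl) w | no 0∉ =
      contradiction (reverse (withoutNew w 0∉)) separated
    addEdge-allBridges bridge {suc f} j w with suc f ∈? edges G⁺ w
    ... | yes f∈ = f∈
    ... | no f∉ with avoiding f w f∉
    ...   | inj₁ (w′ , f∉′)             = contradiction (bridge j w′) f∉′
    ...   | inj₂ (inj₁ (l , r , _)) =
      contradiction (reverse l ⊕ step f j (reverse r)) separated
    ...   | inj₂ (inj₂ (l , r , _)) =
      contradiction (r ⊕ step f (swap j) l) separated

    addEdge-isTree : AllBridges G → (∀ x → Walk G x a ⊎ Walk G x b) → IsTree G⁺
    addEdge-isTree bridge reach = record
      { nonEmpty  = a
      ; connected = λ x y → path (erase (toB x ⊕ reverse (toB y)))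
      ; acyclic   = allBridges⇒acyclic (addEdge-allBridges bridge)
      }
      where
      toB : ∀ x → Walk G⁺ x b
      toB x with reach x
      ... | inj₁ w = mapWalk w ⊕ step zero (inj₁ refl) stop
      ... | inj₂ w = mapWalk w

    addEdge-extendPath : ∀ {x} (P : Path G a x) →
                         Σ[ Q ∈ Path G⁺ b x ] pathLength G⁺ Q ≡ suc (pathLength G P)
    addEdge-extendPath (w , w!) =
      (step zero (inj₂ refl) (mapWalk w) , subst (λ vs → Unique (b ∷ vs)) (sym vs≡) (b# ∷ w!)) ,
      cong suc (trans (cong length (edges-map w)) (length-map suc (edges G w)))
      where
      vs≡ : vertices G⁺ (mapWalk w) ≡ vertices G w
      vs≡ = trans (vertices-map w) (map-id (vertices G w))
      b# : All (b ≢_) (vertices G w)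
      -- If `b` were on the path, the prefix ending there would be a walk of `G` from `a` to `b`.
      b# = All.tabulate λ { z∈ refl → separated (prefix w z∈) }

-- Bounds on spectator floors from trees

module _ {T : Graph} (tree : IsTree T) {d} (isDiam : IsDiameter T d) where
  open Tree tree

  order≤diameter+spectators : ∀ {H s} → T IsMinorOf H → IsSpectatorNumber H s → order T ≤ suc d + s
  order≤diameter+spectators minor = model⇒order≤ (minorModel minor)
    (λ x y → proj₁ (IsTree.connected tree x y) , distance≤diameter isDiam x y)

  order≤diameter+floor : ∀ {s} → IsSpectatorFloor T s → order T ≤ suc d + s
  order≤diameter+floor ((H , minor , isSp) , _) = order≤diameter+spectators minor isSp

  -- `T` itself competes in the minimum that defines the floor of `M`, with spectator number
  -- `order T - (d + 1)`.
  minor-floor+diameter<order : ∀ {M s} → M IsMinorOf T → IsSpectatorFloor M s →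
                               s + suc d ≤ order T
  minor-floor+diameter<order {s = s} minor (_ , minimal) =
    let t , t+1+d≡ , isSp = spectator isDiam
    in subst (s + suc d ≤_) t+1+d≡ (+-monoˡ-≤ (suc d) (minimal t (T , minor , isSp)))

-- Joining a to b turns M into a tree in which P extends by one edge.
split-floor+path<order : ∀ {M a b x s} → AllBridges M → ¬ Walk M a b →
  (∀ z → Walk M z a ⊎ Walk M z b) → (P : Path M a x) → IsSpectatorFloor M s →
  s + suc (suc (pathLength M P)) ≤ order M
split-floor+path<order {M} {a} {b} {s = s} bridge separated reach P floor = begin
  s + suc (suc (pathLength M P)) ≡⟨ cong (λ l → s + suc l) (sym longer) ⟩
  s + suc (pathLength G⁺ Q)      ≤⟨ +-monoʳ-≤ s (s≤s (pathLength≤diameter isDiam Q)) ⟩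
  s + suc (proj₁ diameter)       ≤⟨ minor-floor+diameter<order tree⁺ isDiam
                                      (deleteEdge zero isEdgeDeletion ◅ ε) floor ⟩
  order M                        ∎
  where
  open ≤-Reasoning hiding (stop)
  a≢b : a ≢ b
  a≢b refl = separated stop
  open AddEdge M a b a≢b
  tree⁺ : IsTree G⁺
  tree⁺ = addEdge-isTree separated bridge reach
  open Tree tree⁺
  isDiam = proj₂ diameter
  Q = proj₁ (addEdge-extendPath separated P)
  longer = proj₂ (addEdge-extendPath separated P)

-- Deleting an edge of a tree

module DeletedTreeEdge {T M : Graph} {e : Edge T} (tree : IsTree T) (D : EdgeDeletion T e M) where
  open EdgeDeletion D
  open EnumeratesAllBut edgeMap-all
  open Hom (edgeDeletionHom D)
  open Tree tree using (bridges)

  down : Vertex T → Vertex M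
  down = Inverse.from vertexMap
  up-down : ∀ x → onVertices (down x) ≡ x
  up-down = Inverse.strictlyInverseˡ vertexMap
  down-up : ∀ x → down (onVertices x) ≡ x
  down-up = Inverse.strictlyInverseʳ vertexMap

  lower : ∀ {z x} → onVertices z ≡ x → z ≡ down x
  lower refl = sym (down-up _)

  p q : Vertex T
  p = proj₁ (ends T e)
  q = proj₂ (ends T e)

  lowerJoins : ∀ {f x y} → Joins T f x y → f ≢ e → ∃[ g ] Joins M g (down x) (down y)
  lowerJoins {f} j f≢e with covers f f≢e
  ... | g , refl with sameEnds {T} (preservesJoins g _ _ (inj₁ refl)) j
  ...   | inj₁ (eq₁ , eq₂) = g , inj₁ (cong₂ _,_ (lower eq₁) (lower eq₂))
  ...   | inj₂ (eq₁ , eq₂) = g , inj₂ (cong₂ _,_ (lower eq₁) (lower eq₂))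

  lowerWalk : ∀ {x y} (w : Walk T x y) → e ∉ edges T w →
              Σ[ w′ ∈ Walk M (down x) (down y) ] vertices M w′ ≡ map down (vertices T w)
  lowerWalk stop _ = stop , refl
  lowerWalk (step f j w) e∉ =
    let g , j′ = lowerJoins j (λ f≡e → e∉ (here (sym f≡e)))
        w′ , eq = lowerWalk w (e∉ ∘ there)
    in step g j′ w′ , cong (_ ∷_) eq

  lowerPath : ∀ {x y} (P : Path T x y) → e ∉ pathEdges T P →
              Σ[ P′ ∈ Path M (down x) (down y) ] pathLength M P′ ≡ pathLength T P
  lowerPath (w , w!) e∉ with lowerWalk w e∉
  ... | w′ , eq = (w′ , subst Unique (sym eq) (Unique.map⁺ down-injective w!)) ,
    ℕ.suc-injective (trans (sym (length-vertices w′))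
      (trans (cong length eq) (trans (length-map down (vertices T w)) (length-vertices w))))
    where
    down-injective : ∀ {x y} → down x ≡ down y → x ≡ y
    down-injective {x} {y} eq = trans (sym (up-down x)) (trans (cong onVertices eq) (up-down y))

  upper-avoids : ∀ {x y} (w : Walk M x y) → e ∉ edges T (mapWalk w)
  upper-avoids w e∈ with ∈-map⁻ edgeMap (subst (e ∈_) (edges-map w) e∈)
  ... | g , _ , e≡ = avoids g (sym e≡)

  -- Mapped into `T`, such a walk would join the ends of the bridge `e` without using it.
  deletion-separates : ¬ Walk M (down p) (down q)
  deletion-separates w = upper-avoids w
    (bridges (inj₁ (cong₂ _,_ (sym (up-down p)) (sym (up-down q)))) (mapWalk w))

  deletion-allBridges : AllBridges M
  deletion-allBridges {f} j w
    with ∈-map⁻ edgeMap (subst (edgeMap f ∈_) (edges-map w)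
                               (bridges (preservesJoins f _ _ j) (mapWalk w)))
  ... | g , g∈ , eq with refl ← injective eq = g∈

  -- The walk of `T` from `z` to `p` is followed up to its first use of `e`; it is then at `p` or at
  -- `q`. If it never uses `e`, it arrives at `p`.
  reach : ∀ z → Walk M z (down p) ⊎ Walk M z (down q)
  reach z = subst (λ z → Walk M z (down p) ⊎ Walk M z (down q)) (down-up z)
                  (go (proj₁ (IsTree.connected tree (onVertices z) p)))
    where
    go : ∀ {x} → Walk T x p → Walk M (down x) (down p) ⊎ Walk M (down x) (down q)
    go stop = inj₁ stop
    go (step f j w) with f ≟ e
    ... | yes refl with sameEnds {T} j (inj₁ refl)
    ...   | inj₁ (refl , _) = inj₁ stop
    ...   | inj₂ (refl , _) = inj₂ stop
    go (step f j w) | no f≢e with lowerJoins j f≢e | go w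
    ...   | g , j′ | inj₁ w′ = inj₁ (step g j′ w′)
    ...   | g , j′ | inj₂ w′ = inj₂ (step g j′ w′)

  deletion-order : order M ≡ order T
  deletion-order = ↔⇒≡ vertexMap

  -- The path survives in `M`, and its start lies on the side of `p` or of `q`. The new edge runs
  -- from that start to the end of `e` on the other side.
  floor+avoidingPath<order : ∀ {x y s} (P : Path T x y) → e ∉ pathEdges T P → IsSpectatorFloor M s →
                             s + suc (suc (pathLength T P)) ≤ order T
  floor+avoidingPath<order {x} {y} {s} P e∉ floor with lowerPath P e∉ | reach (down x)
  ... | P′ , eq | inj₁ w =
    subst₂ (λ l n → s + suc (suc l) ≤ n) eq deletion-order
      (split-floor+path<order deletion-allBridges (deletion-separates ∘ (reverse w ⊕_))
        (λ z → map₁ (_⊕ reverse w) (reach z)) P′ floor)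
  ... | P′ , eq | inj₂ w =
    subst₂ (λ l n → s + suc (suc l) ≤ n) eq deletion-order
      (split-floor+path<order deletion-allBridges
        (λ w′ → deletion-separates (reverse (reverse w ⊕ w′)))
        (λ z → map₁ (_⊕ reverse w) (swap (reach z))) P′ floor)

-- Comparing the floors of a tree and its elementary minors

module _ {T : Graph} (tree : IsTree T) where
  open IsTree tree using (connected)
  open Tree tree

  -- The common value is the spectator number of `T`, which has both `T` and `G` as minors.
  contraction⇒sameFloor : ∀ {e G d d′} → Contraction T e G → IsDiameter T d → IsDiameter G d′ →
                          d′ < d → SameSpectatorFloor G T
  contraction⇒sameFloor {e} {G} {d} {d′} C isDiam isDiam′ d′<d with spectator isDiam
  ... | s , s+1+d≡ , isSp = s ,
    ((T , contractEdge e C ◅ ε , isSp) ,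
     λ { j (H , minor , isSp′) → +-cancelʳ-≤ (suc d) s j (begin
           s + suc d        ≡⟨ s+1+d≡ ⟩
           order T          ≡⟨ contraction-order ⟩
           suc (order G)    ≤⟨ s≤s (order≤diameter+spectators treeG isDiam′ minor isSp′) ⟩
           -- The drop in diameter pays for the vertex lost in the contraction.
           suc (suc d′) + j ≤⟨ +-monoˡ-≤ j (s≤s d′<d) ⟩
           suc d + j        ≡⟨ +-comm (suc d) j ⟩
           j + suc d        ∎) }) ,
    ((T , ε , isSp) ,
     λ { j (H , minor , isSp′) → +-cancelʳ-≤ (suc d) s j (begin
           s + suc d ≡⟨ s+1+d≡ ⟩
           order T   ≤⟨ order≤diameter+spectators tree isDiam minor isSp′ ⟩
           suc d + j ≡⟨ +-comm (suc d) j ⟩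
           j + suc d ∎) })
    where
    open ≤-Reasoning
    open ContractionWalks C
    treeG = contraction-isTree tree

  -- The upper bound on the floor of `G` and the lower bound on that of `T` are compared at the same
  -- `s`; since `G` has one vertex fewer, its diameter must be smaller.
  contraction-reducesDiameter : ∀ {e G s} → Contraction T e G →
    IsSpectatorFloor G s → IsSpectatorFloor T s → ContractingReducesDiameter T e
  contraction-reducesDiameter {e} {G} {s} C floorG floorT =
    G , d , d′ , C , isDiam , isDiam′ , +-cancelʳ-≤ (suc s) (suc d′) d (begin
      suc d′ + suc s   ≡⟨ +-comm (suc d′) (suc s) ⟩
      suc (s + suc d′) ≤⟨ s≤s (minor-floor+diameter<order treeG isDiam′ ε floorG) ⟩
      suc (order G)    ≡⟨ sym contraction-order ⟩
      order T          ≤⟨ order≤diameter+floor tree isDiam floorT ⟩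
      suc d + s        ≡⟨ sym (+-suc d s) ⟩
      d + suc s        ∎)
    where
    open ≤-Reasoning
    open ContractionWalks C
    treeG = contraction-isTree tree
    d = proj₁ diameter
    isDiam = proj₂ diameter
    d′ = proj₁ (Tree.diameter treeG)
    isDiam′ = proj₂ (Tree.diameter treeG)

  -- `a` and `b` are preimages of the ends of a diametral path of `G`. The path of `T` between them
  -- projects to a walk of length at least `d′`, and the projection loses an edge if `e` was used.
  diametralLift : ∀ {e G d′} → Contraction T e G → IsDiameter G d′ →
    ∃[ a ] ∃[ b ] (d′ ≤ distance a b × (e ∈ pathEdges T (connected a b) → d′ < distance a b))
  diametralLift {G = G} C isDiam′ with Tree.diametralPath (contraction-isTree tree) isDiam′
    where open ContractionWalks C
  ... | x , y , P , refl with Contraction.surjective C x | Contraction.surjective C y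
  ...   | a , refl | b , refl =
    let w , ≤w , <w = projectWalk (proj₁ (connected a b))
        P≤w = subst (_≤ length (edges G w)) (sym (G.pathLength≡distance P)) (G.distance≤walk w)
    in a , b , ≤-trans P≤w ≤w , λ e∈ → ≤-<-trans P≤w (<w e∈)
    where
    open ContractionWalks C
    module G = Tree (contraction-isTree tree)

  deletion-reducesDiameter : ∀ {e M s} → EdgeDeletion T e M →
    IsSpectatorFloor M s → IsSpectatorFloor T s → ContractingReducesDiameter T e
  deletion-reducesDiameter {e} {M} {s} D floorM floorT
    with contraction e (allBridges⇒noParallel bridges e)
  ... | G , C = G , d , d′ , C , isDiam , isDiam′ , d′<d
    where
    d = proj₁ diameter
    isDiam = proj₂ diameter
    treeG = ContractionWalks.contraction-isTree C tree
    d′ = proj₁ (Tree.diameter treeG)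
    isDiam′ = proj₂ (Tree.diameter treeG)
    open ≤-Reasoning
    d′<d : d′ < d
    d′<d with diametralLift C isDiam′
    ... | a , b , d′≤ , d′< with e ∈? pathEdges T (connected a b)
    ...   | yes e∈ = ≤-trans (d′< e∈) (distance≤diameter isDiam a b)
    -- With `l = distance a b`, the tree built from `T - e` gives `s + l + 2 ≤ order T`, and
    -- `order T ≤ d + 1 + s`; so `d′ ≤ l < d`.
    ...   | no e∉ = +-cancelʳ-≤ (suc s) (suc d′) d (begin
      suc d′ + suc s               ≡⟨ +-suc (suc d′) s ⟩
      suc (suc d′) + s             ≡⟨ +-comm (suc (suc d′)) s ⟩
      s + suc (suc d′)             ≤⟨ +-monoʳ-≤ s (s≤s (s≤s d′≤)) ⟩
      s + suc (suc (distance a b)) ≤⟨ DeletedTreeEdge.floor+avoidingPath<order tree D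
                                        (connected a b) e∉ floorM ⟩
      order T                      ≤⟨ order≤diameter+floor tree isDiam floorT ⟩
      suc d + s                    ≡⟨ sym (+-suc d s) ⟩
      d + suc s                    ∎)

  -- A vertex of `M` gives a vertex of `T` other than `v`, and the path from `v` to it starts with
  -- an edge at `v`, which is isolated.
  noVertexDeletion : ∀ {v M} → NonEmpty M → ¬ VertexDeletion T v M
  noVertexDeletion {v} m D = go (proj₁ (connected v (vertexMap m))) (avoids m)
    where
    open VertexDeletion D
    open EnumeratesAllBut vertexMap-all
    go : ∀ {x} → Walk T v x → ¬ (x ≢ v)
    go stop         v≢v = v≢v refl
    go (step e j w) _   = isolated e _ j

theorem4p3 : (T : Graph) → IsTree T →
    (∃[ M ] (NonEmpty M × M IsElementaryMinorOf T × SameSpectatorFloor M T))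
    ⇔ (∃[ e ] ContractingReducesDiameter T e)
theorem4p3 T tree = mk⇔ to from
  where
  to : ∃[ M ] (NonEmpty M × M IsElementaryMinorOf T × SameSpectatorFloor M T) →
       ∃[ e ] ContractingReducesDiameter T e
  to (M , m , deleteVertex v D , _) = contradiction D (noVertexDeletion tree m)
  to (M , m , deleteEdge e D , s , floorM , floorT) =
    e , deletion-reducesDiameter tree D floorM floorT
  to (M , m , contractEdge e C , s , floorM , floorT) =
    e , contraction-reducesDiameter tree C floorM floorT
  from : ∃[ e ] ContractingReducesDiameter T e →
         ∃[ M ] (NonEmpty M × M IsElementaryMinorOf T × SameSpectatorFloor M T)
  from (e , G , d , d′ , C , isDiam , isDiam′ , d′<d) =
    G , Contraction.vertexMap C (IsTree.nonEmpty tree) , contractEdge e C ,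
    contraction⇒sameFloor tree C isDiam isDiam′ d′<d
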